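{- Let $K$ be a positive integer, and let $(a(n))_{n\ge 1}$ be the sequence of rational numbers defined by the initial conditions $a(m)=1$ for $1\le m\le 2K+1$ and, for all $n\ge 2K+2$, by the quadratic recurrence $$a(n)\,a(n-(2K+1)) = a(n-1)\,a(n-2K)+a(n-K)+a(n-K-1).$$ Then for all $n\ge 6K+2$ the sequence also satisfies the linear recurrence $$a(n)=\left(2K^2+8K+4\right)\bigl(a(n-2K)-a(n-4K)\bigr)+a(n-6K).$$ (Equivalently, the sequence is the one generated by this linear recurrence for $n\ge 6K+2$ with its initial $6K+1$ values taken to be the first $6K+1$ values of the sequence given by the quadratic recurrence.)
   Context: The quadratic recurrence determines $a(n)$ by dividing by $a(n-(2K+1))$, i.e. $a(n)=\bigl(a(n-1)a(n-2K)+a(n-K)+a(n-K-1)\bigr)/a(n-(2K+1))$. -}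

module Defs where

open import Data.Nat.Base as ℕ using (ℕ; _∸_; _≤_)
open import Data.Integer.Base using (+_)
open import Data.Rational.Base using (ℚ; 1ℚ; _+_; _*_; _-_; _/_)
open import Relation.Binary.PropositionalEquality using (_≡_)

-- Sequences are indexed from 1; the value a 0 is unconstrained and never used.
-- In both recurrences the range of n makes every index positive, so the
-- truncated subtraction ∸ agrees with the usual one.

-- The recurrence can be solved for a n by dividing by a (n ∸ (2K+1)), which
-- is inductively positive; hence exactly one sequence on the positive indices
-- has this property.
record IsQuadraticSequence (K : ℕ) (a : ℕ → ℚ) : Set where
  field
    initial    : ∀ m → 1 ≤ m → m ≤ 2 ℕ.* K ℕ.+ 1 → a m ≡ 1ℚ
    recurrence : ∀ n → 2 ℕ.* K ℕ.+ 2 ≤ n →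
      a n * a (n ∸ (2 ℕ.* K ℕ.+ 1))
        ≡ a (n ∸ 1) * a (n ∸ 2 ℕ.* K) + a (n ∸ K) + a (n ∸ K ∸ 1)

coefficient : ℕ → ℚ
coefficient K = + (2 ℕ.* K ℕ.^ 2 ℕ.+ 8 ℕ.* K ℕ.+ 4) / 1

SatisfiesLinearRecurrence : (K : ℕ) (a : ℕ → ℚ) → Set
SatisfiesLinearRecurrence K a = ∀ n → 6 ℕ.* K ℕ.+ 2 ≤ n →
  a n ≡ coefficient K * (a (n ∸ 2 ℕ.* K) - a (n ∸ 4 ℕ.* K)) + a (n ∸ 6 ℕ.* K)

{-# OPTIONS --safe #-}
-- Arrange the sequence in the array f j i = a (j K + i). The recurrence says that
-- the 2×2 minor on rows j, j+2 and columns i, i+1 is f (j+1) (i+1) + f (j+1) i. By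
-- condensation the 3×3 minors δ on rows j, j+2, j+4 and three consecutive columns
-- are then a symmetric expression in rows j+1 and j+2, which yields δ (j+1) = δ j.
-- From δ (j+2) = δ j, the linear relation propagates: if it holds in columns i and
-- i+1, it holds in column i+2. To have two easy initial columns, a is extended
-- backwards by reflection about K+1, a symmetry of the recurrence and of the
-- initial values; only closed forms up to a (4K+2) are then required.
module Submission where

open import Defs
open import Data.Integer.Base as ℤ using (+_)
import Data.Integer.Properties as ℤ
open import Data.List.Base using ([]; _∷_)
open import Data.Nat.Base as ℕ using (ℕ; zero; suc; _∸_; _≤_; z≤n; s≤s)
open import Data.Nat.Induction using (<-rec)
import Data.Nat.Properties as ℕ
open import Data.Nat.Tactic.RingSolver using (solve)
open import Data.Product.Base using (_,_)
open import Data.Rational.Base using (ℚ; 0ℚ; 1ℚ; _+_; _*_; _-_; _/_; _<_; Positive; positive; toℚᵘ)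
open import Data.Rational.Properties
open import Data.Rational.Solver using (module +-*-Solver)
open import Data.Rational.Unnormalised.Base as ℚᵘ using (mkℚᵘ; *≡*)
import Data.Rational.Unnormalised.Properties as ℚᵘ
open import Data.Sum.Base using (inj₁; inj₂)
open import Relation.Binary.PropositionalEquality
open import Relation.Nullary using (yes; no)

open +-*-Solver using (_:+_; _:*_; _:-_; _:=_) renaming (solve to solveℚ)

-- Cancellation of positive rational factors.

*-cancelʳ-≡-pos : ∀ {p q} r .{{_ : Positive r}} → p * r ≡ q * r → p ≡ q
*-cancelʳ-≡-pos r pr≡qr = ≤-antisym
  (*-cancelʳ-≤-pos r (≤-reflexive pr≡qr))
  (*-cancelʳ-≤-pos r (≤-reflexive (sym pr≡qr)))

pos*⇒pos : ∀ p q .{{_ : Positive q}} → Positive (p * q) → Positive p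
pos*⇒pos p q pq>0 = positive (*-cancelʳ-<-nonNeg q {{pos⇒nonNeg q}} {0ℚ} {p}
  (subst (_< p * q) (sym (*-zeroˡ q)) (positive⁻¹ (p * q) {{pq>0}})))

≡+⇒-≡ : ∀ {p} q r s → p ≡ q + r + s → p - q ≡ r + s
≡+⇒-≡ q r s refl = solveℚ 3 (λ q r s → q :+ r :+ s :- q := r :+ s) refl q r s

-- Determinants on consecutive columns.

det : (r₀ r₁ r₂ : ℕ → ℚ) → ℕ → ℚ
det r₀ r₁ r₂ i =
    r₀ i       * (r₁ (1 ℕ.+ i) * r₂ (2 ℕ.+ i) - r₁ (2 ℕ.+ i) * r₂ (1 ℕ.+ i))
  - r₀ (1 ℕ.+ i) * (r₁ i       * r₂ (2 ℕ.+ i) - r₁ (2 ℕ.+ i) * r₂ i)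
  + r₀ (2 ℕ.+ i) * (r₁ i       * r₂ (1 ℕ.+ i) - r₁ (1 ℕ.+ i) * r₂ i)

-- The factors stand in the order of the quadratic recurrence, so that `f-minor` only has to move
-- one product to the other side.
minor : (r₀ r₁ : ℕ → ℚ) → ℕ → ℚ
minor r₀ r₁ i = r₁ (1 ℕ.+ i) * r₀ i - r₁ i * r₀ (1 ℕ.+ i)

-- The Desnanot-Jacobi identity behind Dodgson condensation. The four minors on the right are the
-- corner minors, each on adjacent rows and columns.
det-condensation : ∀ r₀ r₁ r₂ i → det r₀ r₁ r₂ i * r₁ (1 ℕ.+ i)
  ≡ minor r₀ r₁ i * minor r₁ r₂ (1 ℕ.+ i) - minor r₀ r₁ (1 ℕ.+ i) * minor r₁ r₂ i
det-condensation r₀ r₁ r₂ i = solveℚ 9 (λ a b c d e f g h i →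
  (a :* (e :* i :- f :* h) :- b :* (d :* i :- f :* g) :+ c :* (d :* h :- e :* g)) :* e
    := (e :* a :- d :* b) :* (i :* e :- h :* f) :- (f :* b :- e :* c) :* (h :* d :- g :* e))
  refl
  (r₀ i) (r₀ (1 ℕ.+ i)) (r₀ (2 ℕ.+ i))
  (r₁ i) (r₁ (1 ℕ.+ i)) (r₁ (2 ℕ.+ i))
  (r₂ i) (r₂ (1 ℕ.+ i)) (r₂ (2 ℕ.+ i))

-- For rows lying 2K apart in the sequence and `k` the coefficient, this is the linear recurrence at
-- one index.
Combination : ℚ → (r₀ r₁ r₂ r₃ : ℕ → ℚ) → ℕ → Set
Combination k r₀ r₁ r₂ r₃ i = r₃ i ≡ k * (r₂ i - r₁ i) + r₀ i

-- Subtracting k (r₂ - r₁) from r₃ does not change det r₁ r₂ r₃, so the two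
-- determinants differ by the defect in the last column times a minor of r₁, r₂.
det-cyclic⇒combination : ∀ k r₀ r₁ r₂ r₃ i → Positive (minor r₁ r₂ i) →
  det r₁ r₂ r₃ i ≡ det r₀ r₁ r₂ i →
  Combination k r₀ r₁ r₂ r₃ i → Combination k r₀ r₁ r₂ r₃ (1 ℕ.+ i) →
  Combination k r₀ r₁ r₂ r₃ (2 ℕ.+ i)
det-cyclic⇒combination k r₀ r₁ r₂ r₃ i m>0 δ′≡δ h₀ h₁ =
  *-cancelʳ-≡-pos m {{m>0}} (begin
    z * m
      -- If all of `r₃` were the combination, `det r₁ r₂ r₃` would equal `det r₀ r₁ r₂`, since a
      -- cyclic shift of three rows is even. Here only the last entry `z` is free, and its cofactor
      -- is `m`.
      ≡⟨ solveℚ 11 (λ k a b c d e f g h i z →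
           z :* (h :* d :- g :* e) :=
             (d :* (h :* z :- i :* (k :* (h :- e) :+ b)) :- e :* (g :* z :- i :* (k :* (g :- d) :+ a))
               :+ f :* (g :* (k :* (h :- e) :+ b) :- h :* (k :* (g :- d) :+ a)))
             :- (a :* (e :* i :- f :* h) :- b :* (d :* i :- f :* g) :+ c :* (d :* h :- e :* g))
             :+ (k :* (i :- f) :+ c) :* (h :* d :- g :* e))
           refl k
           (r₀ i) (r₀ (1 ℕ.+ i)) (r₀ (2 ℕ.+ i))
           (r₁ i) (r₁ (1 ℕ.+ i)) (r₁ (2 ℕ.+ i))
           (r₂ i) (r₂ (1 ℕ.+ i)) (r₂ (2 ℕ.+ i)) z ⟩
    expand (k * (r₂ i - r₁ i) + r₀ i) (k * (r₂ (1 ℕ.+ i) - r₁ (1 ℕ.+ i)) + r₀ (1 ℕ.+ i)) - δ + w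
      ≡⟨ cong₂ (λ x y → expand x y - δ + w) h₀ h₁ ⟨
    det r₁ r₂ r₃ i - δ + w           ≡⟨ cong (λ t → t - δ + w) δ′≡δ ⟩
    δ - δ + w                        ≡⟨ cong (_+ w) (+-inverseʳ δ) ⟩
    0ℚ + w                           ≡⟨ +-identityˡ w ⟩
    w ∎)
  where
  open ≡-Reasoning
  m = minor r₁ r₂ i
  z = r₃ (2 ℕ.+ i)
  δ = det r₀ r₁ r₂ i
  w = (k * (r₂ (2 ℕ.+ i) - r₁ (2 ℕ.+ i)) + r₀ (2 ℕ.+ i)) * m
  -- `det r₁ r₂ r₃ i` with the first two entries of `r₃` as variables, into which `h₀` and `h₁` are
  -- substituted.
  expand : ℚ → ℚ → ℚ
  expand x y = r₁ i * (r₂ (1 ℕ.+ i) * z - r₂ (2 ℕ.+ i) * y)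
    - r₁ (1 ℕ.+ i) * (r₂ i * z - r₂ (2 ℕ.+ i) * x)
    + r₁ (2 ℕ.+ i) * (r₂ i * y - r₂ (1 ℕ.+ i) * x)

-- Invariance of the determinants in a quadratic array.

module QuadraticArray
  (f : ℕ → ℕ → ℚ) (f-positive : ∀ j i → Positive (f j i))
  (f-recurrence : ∀ j i → f (2 ℕ.+ j) (1 ℕ.+ i) * f j i
    ≡ f (2 ℕ.+ j) i * f j (1 ℕ.+ i) + f (1 ℕ.+ j) (1 ℕ.+ i) + f (1 ℕ.+ j) i)
  where

  open ≡-Reasoning

  f-minor : ∀ j i → minor (f j) (f (2 ℕ.+ j)) i ≡ f (1 ℕ.+ j) (1 ℕ.+ i) + f (1 ℕ.+ j) i
  f-minor j i = ≡+⇒-≡ (f (2 ℕ.+ j) i * f j (1 ℕ.+ i)) (f (1 ℕ.+ j) (1 ℕ.+ i)) (f (1 ℕ.+ j) i)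
    (f-recurrence j i)

  δ : ℕ → ℕ → ℚ
  δ j = det (f j) (f (2 ℕ.+ j)) (f (4 ℕ.+ j))

  -- s, t, u are the middle entries of rows j+1, j+2, j+3, and t is the centre of δ j i.
  module Block (j i : ℕ) where
    s₋ s s₊ t₋ t t₊ u₋ u u₊ : ℚ
    s₋ = f (1 ℕ.+ j) i
    s  = f (1 ℕ.+ j) (1 ℕ.+ i)
    s₊ = f (1 ℕ.+ j) (2 ℕ.+ i)
    t₋ = f (2 ℕ.+ j) i
    t  = f (2 ℕ.+ j) (1 ℕ.+ i)
    t₊ = f (2 ℕ.+ j) (2 ℕ.+ i)
    u₋ = f (3 ℕ.+ j) i
    u  = f (3 ℕ.+ j) (1 ℕ.+ i)
    u₊ = f (3 ℕ.+ j) (2 ℕ.+ i)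

    -- `right` and `left` serve to eliminate the outer entries of row j+3: multiplied by `s`, they
    -- are expressed by `u` and the two rows before.
    right : u₊ * s ≡ u * s₊ + t₊ + t
    right = f-recurrence (1 ℕ.+ j) (1 ℕ.+ i)

    left : u₋ * s ≡ u * s₋ - (t + t₋)
    left = begin
      u₋ * s                     ≡⟨ solveℚ 3 (λ x y z → x := x :+ y :+ z :- (y :+ z)) refl (u₋ * s) t t₋ ⟩
      u₋ * s + t + t₋ - (t + t₋) ≡⟨ cong (_- (t + t₋)) (f-recurrence (1 ℕ.+ j) i) ⟨
      u * s₋ - (t + t₋)          ∎

  -- Condensation gives δ t as a difference of products of sums taken from the rows `s` and `u`.
  -- After multiplication by `s` and elimination of `u₊` and `u₋`, the terms in `u` cancel. What
  -- remains is symmetric under exchange of the rows `s` and `t`.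
  δ*t*s : ∀ j i → let open Block j i in
    δ j i * t * s ≡ (s + s₋) * (t + t₊) + (s + s₊) * (t + t₋)
  δ*t*s j i = begin
    δ j i * t * s
      ≡⟨ cong (_* s) (det-condensation (f j) (f (2 ℕ.+ j)) (f (4 ℕ.+ j)) i) ⟩
    _ ≡⟨ cong (_* s) (cong₂ _-_
           (cong₂ _*_ (f-minor j i) (f-minor (2 ℕ.+ j) (1 ℕ.+ i)))
           (cong₂ _*_ (f-minor j (1 ℕ.+ i)) (f-minor (2 ℕ.+ j) i))) ⟩
    ((s + s₋) * (u₊ + u) - (s₊ + s) * (u + u₋)) * s
      ≡⟨ solveℚ 6 (λ s₋ s s₊ u₋ u u₊ →
           ((s :+ s₋) :* (u₊ :+ u) :- (s₊ :+ s) :* (u :+ u₋)) :* s :=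
           (s :+ s₋) :* (u₊ :* s :+ u :* s) :- (s₊ :+ s) :* (u :* s :+ u₋ :* s))
         refl s₋ s s₊ u₋ u u₊ ⟩
    (s + s₋) * (u₊ * s + u * s) - (s₊ + s) * (u * s + u₋ * s)
      ≡⟨ cong₂ (λ x y → (s + s₋) * (x + u * s) - (s₊ + s) * (u * s + y)) right left ⟩
    (s + s₋) * (u * s₊ + t₊ + t + u * s) - (s₊ + s) * (u * s + (u * s₋ - (t + t₋)))
      ≡⟨ solveℚ 7 (λ s₋ s s₊ t₋ t t₊ u →
           (s :+ s₋) :* (u :* s₊ :+ t₊ :+ t :+ u :* s)
             :- (s₊ :+ s) :* (u :* s :+ (u :* s₋ :- (t :+ t₋))) :=
           (s :+ s₋) :* (t :+ t₊) :+ (s :+ s₊) :* (t :+ t₋))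
         refl s₋ s s₊ t₋ t t₊ u ⟩
    (s + s₋) * (t + t₊) + (s + s₊) * (t + t₋) ∎
    where open Block j i

  -- Apply `δ*t*s` one row further down and eliminate `u₊` and `u₋` again. The products of two
  -- entries of row `t` cancel, and `u` times the symmetric expression for `δ j i` is left.
  δ-suc : ∀ j i → δ (1 ℕ.+ j) i ≡ δ j i
  δ-suc j i = *-cancelʳ-≡-pos t (*-cancelʳ-≡-pos s (*-cancelʳ-≡-pos u (begin
    δ (1 ℕ.+ j) i * t * s * u
      ≡⟨ solveℚ 4 (λ d s t u → d :* t :* s :* u := d :* u :* t :* s) refl (δ (1 ℕ.+ j) i) s t u ⟩
    δ (1 ℕ.+ j) i * u * t * s
      ≡⟨ cong (_* s) (δ*t*s (1 ℕ.+ j) i) ⟩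
    ((t + t₋) * (u + u₊) + (t + t₊) * (u + u₋)) * s
      ≡⟨ solveℚ 7 (λ s t₋ t t₊ u₋ u u₊ →
           ((t :+ t₋) :* (u :+ u₊) :+ (t :+ t₊) :* (u :+ u₋)) :* s :=
           (t :+ t₋) :* (u :* s :+ u₊ :* s) :+ (t :+ t₊) :* (u :* s :+ u₋ :* s))
         refl s t₋ t t₊ u₋ u u₊ ⟩
    (t + t₋) * (u * s + u₊ * s) + (t + t₊) * (u * s + u₋ * s)
      ≡⟨ cong₂ (λ x y → (t + t₋) * (u * s + x) + (t + t₊) * (u * s + y)) right left ⟩
    (t + t₋) * (u * s + (u * s₊ + t₊ + t)) + (t + t₊) * (u * s + (u * s₋ - (t + t₋)))
      ≡⟨ solveℚ 7 (λ s₋ s s₊ t₋ t t₊ u →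
           (t :+ t₋) :* (u :* s :+ (u :* s₊ :+ t₊ :+ t))
             :+ (t :+ t₊) :* (u :* s :+ (u :* s₋ :- (t :+ t₋))) :=
           ((s :+ s₋) :* (t :+ t₊) :+ (s :+ s₊) :* (t :+ t₋)) :* u)
         refl s₋ s s₊ t₋ t t₊ u ⟩
    ((s + s₋) * (t + t₊) + (s + s₊) * (t + t₋)) * u
      ≡⟨ cong (_* u) (δ*t*s j i) ⟨
    δ j i * t * s * u ∎)))
    where
    open Block j i
    instance
      s-positive = f-positive (1 ℕ.+ j) (1 ℕ.+ i)
      t-positive = f-positive (2 ℕ.+ j) (1 ℕ.+ i)
      u-positive = f-positive (3 ℕ.+ j) (1 ℕ.+ i)

  -- The value of `k` is arbitrary here; it is pinned down only by the two initial columns.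
  f-combination : ∀ k → let P = Combination k (f 0) (f 2) (f 4) (f 6) in P 0 → P 1 → ∀ i → P i
  f-combination k h₀ h₁ 0 = h₀
  f-combination k h₀ h₁ 1 = h₁
  f-combination k h₀ h₁ (suc (suc i)) =
    det-cyclic⇒combination k (f 0) (f 2) (f 4) (f 6) i
      -- The minor to be cancelled belongs to rows 2 and 4, so it is a sum of two entries of row 3.
      (subst Positive (sym (f-minor 2 i))
        (pos+pos⇒pos (f 3 (1 ℕ.+ i)) {{f-positive 3 (1 ℕ.+ i)}} (f 3 i) {{f-positive 3 i}}))
      -- Two row shifts lead from rows 0, 2, 4 to rows 2, 4, 6.
      (trans (δ-suc 1 i) (δ-suc 0 i))
      (f-combination k h₀ h₁ i) (f-combination k h₀ h₁ (suc i))

-- Natural numbers as rationals.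

-- `coefficient K` is by definition a value of `ι`, so the closed forms below reduce to arithmetic
-- in ℕ.
ι : ℕ → ℚ
ι n = + n / 1

-- For variable `n` the normalisation by a gcd in `+ n / 1` is stuck. The unnormalised fraction with
-- denominator 1 can be added and multiplied by computation.
toℚᵘ-ι : ∀ n → toℚᵘ (ι n) ℚᵘ.≃ mkℚᵘ (+ n) 0
toℚᵘ-ι n = toℚᵘ-fromℚᵘ (mkℚᵘ (+ n) 0)

ι-homo-+ : ∀ m n → ι (m ℕ.+ n) ≡ ι m + ι n
ι-homo-+ m n = toℚᵘ-injective (begin
  toℚᵘ (ι (m ℕ.+ n))                 ≈⟨ toℚᵘ-ι (m ℕ.+ n) ⟩
  mkℚᵘ (+ (m ℕ.+ n)) 0               ≈⟨ *≡* (cong (ℤ._* ℤ.1ℤ)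
                                         (cong₂ ℤ._+_ (ℤ.*-identityʳ (+ m)) (ℤ.*-identityʳ (+ n)))) ⟨
  mkℚᵘ (+ m) 0 ℚᵘ.+ mkℚᵘ (+ n) 0     ≈⟨ ℚᵘ.+-cong (toℚᵘ-ι m) (toℚᵘ-ι n) ⟨
  toℚᵘ (ι m) ℚᵘ.+ toℚᵘ (ι n)         ≈⟨ toℚᵘ-homo-+ (ι m) (ι n) ⟨
  toℚᵘ (ι m + ι n)                   ∎)
  where open ℚᵘ.≃-Reasoning

ι-homo-* : ∀ m n → ι (m ℕ.* n) ≡ ι m * ι n
ι-homo-* m n = toℚᵘ-injective (begin
  toℚᵘ (ι (m ℕ.* n))                 ≈⟨ toℚᵘ-ι (m ℕ.* n) ⟩
  mkℚᵘ (+ (m ℕ.* n)) 0               ≈⟨ *≡* (cong (ℤ._* ℤ.1ℤ) (ℤ.pos-* m n)) ⟩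
  mkℚᵘ (+ m) 0 ℚᵘ.* mkℚᵘ (+ n) 0     ≈⟨ ℚᵘ.*-cong (toℚᵘ-ι m) (toℚᵘ-ι n) ⟨
  toℚᵘ (ι m) ℚᵘ.* toℚᵘ (ι n)         ≈⟨ toℚᵘ-homo-* (ι m) (ι n) ⟨
  toℚᵘ (ι m * ι n)                   ∎)
  where open ℚᵘ.≃-Reasoning

ι-homo-+-+ : ∀ l m n → ι l + ι m + ι n ≡ ι (l ℕ.+ m ℕ.+ n)
ι-homo-+-+ l m n = trans (cong (_+ ι n) (sym (ι-homo-+ l m))) (sym (ι-homo-+ (l ℕ.+ m) n))

-- The recurrence without subtraction, and positivity.

module QuadraticSequence
  (K : ℕ) (1≤K : 1 ≤ K) (a : ℕ → ℚ) (a-quadratic : IsQuadraticSequence K a) where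

  open IsQuadraticSequence a-quadratic
  open ≡-Reasoning

  a≡1 : ∀ m → m ≤ 2 ℕ.* K → a (1 ℕ.+ m) ≡ 1ℚ
  a≡1 m m≤2K = initial (1 ℕ.+ m) (s≤s z≤n)
    (subst (1 ℕ.+ m ≤_) (ℕ.+-comm 1 (2 ℕ.* K)) (s≤s m≤2K))

  -- Writing the index as 2K + 2 + n turns every truncated subtraction into a sum and makes every
  -- index visibly positive.
  a-recurrence : ∀ n → a (2 ℕ.+ (2 ℕ.* K ℕ.+ n)) * a (1 ℕ.+ n)
    ≡ a (1 ℕ.+ (2 ℕ.* K ℕ.+ n)) * a (2 ℕ.+ n) + a (2 ℕ.+ (K ℕ.+ n)) + a (1 ℕ.+ (K ℕ.+ n))
  a-recurrence n = begin
    a N * a (1 ℕ.+ n)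
      ≡⟨ cong (λ p → a N * a p) (N∸ (2 ℕ.* K ℕ.+ 1) (1 ℕ.+ n) (solve (K ∷ n ∷ []))) ⟨
    a N * a (N ∸ (2 ℕ.* K ℕ.+ 1))
      ≡⟨ recurrence N (ℕ.m+n≤o⇒m≤o (2 ℕ.* K ℕ.+ 2) {n} (ℕ.≤-reflexive 2K+2+n≡N)) ⟩
    a (N ∸ 1) * a (N ∸ 2 ℕ.* K) + a (N ∸ K) + a (N ∸ K ∸ 1)
      ≡⟨ cong₂ (λ p q → a (N ∸ 1) * a p + a q + a (q ∸ 1))
           (N∸ (2 ℕ.* K) (2 ℕ.+ n) (solve (K ∷ n ∷ [])))
           (N∸ K (2 ℕ.+ (K ℕ.+ n)) (solve (K ∷ n ∷ []))) ⟩
    a (1 ℕ.+ (2 ℕ.* K ℕ.+ n)) * a (2 ℕ.+ n) + a (2 ℕ.+ (K ℕ.+ n)) + a (1 ℕ.+ (K ℕ.+ n)) ∎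
    where
    N = 2 ℕ.+ (2 ℕ.* K ℕ.+ n)
    N∸ : ∀ d r → 2 ℕ.+ (2 ℕ.* K ℕ.+ n) ≡ d ℕ.+ r → N ∸ d ≡ r
    N∸ d r N≡d+r = trans (cong (_∸ d) N≡d+r) (ℕ.m+n∸m≡n d r)
    2K+2+n≡N : 2 ℕ.* K ℕ.+ 2 ℕ.+ n ≡ 2 ℕ.+ (2 ℕ.* K ℕ.+ n)
    2K+2+n≡N = solve (K ∷ n ∷ [])

  -- Strong induction: the right-hand side of the recurrence is positive, and so is the factor
  -- `a (1 + n)` by which the new term is multiplied.
  a-positive : ∀ m → Positive (a (1 ℕ.+ m))
  a-positive = <-rec (λ m → Positive (a (1 ℕ.+ m))) step
    where
    step : ∀ m → (∀ {i} → i ℕ.< m → Positive (a (1 ℕ.+ i))) → Positive (a (1 ℕ.+ m))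
    step m ih with m ℕ.≤? 2 ℕ.* K
    ... | yes m≤2K = subst Positive (sym (a≡1 m m≤2K)) _
    ... | no m≰2K with ℕ.m≤n⇒∃[o]m+o≡n (ℕ.≰⇒> m≰2K)
    ...   | n , refl =
      pos*⇒pos (a (2 ℕ.+ (2 ℕ.* K ℕ.+ n))) (a (1 ℕ.+ n)) (subst Positive (sym (a-recurrence n))
        (pos+pos⇒pos (x * y + z) {{pos+pos⇒pos (x * y) {{pos*pos⇒pos x y}} z}} w))
      where
      x = a (1 ℕ.+ (2 ℕ.* K ℕ.+ n))
      y = a (2 ℕ.+ n)
      z = a (2 ℕ.+ (K ℕ.+ n))
      w = a (1 ℕ.+ (K ℕ.+ n))
      instance
        x-positive : Positive x
        x-positive = ih ℕ.≤-refl
        -- Here and for `z`, K ≥ 1 is what makes the index smaller than that of the new term.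
        y-positive : Positive y
        y-positive = ih (s≤s (ℕ.+-monoˡ-≤ n (ℕ.≤-trans 1≤K (ℕ.m≤m+n K _))))
        z-positive : Positive z
        z-positive = ih (s≤s (ℕ.+-monoˡ-≤ n
          (ℕ.≤-trans (ℕ.+-monoˡ-≤ K 1≤K) (ℕ.+-monoʳ-≤ K (ℕ.m≤m+n K 0)))))
        w-positive : Positive w
        w-positive = ih (s≤s (ℕ.+-monoˡ-≤ n (ℕ.m≤m+n K _)))
        a[1+n]-positive : Positive (a (1 ℕ.+ n))
        a[1+n]-positive = ih (s≤s (ℕ.m≤n+m n (2 ℕ.* K)))

  -- Backward extension by reflection.

  -- k stands for the index k + 1 - 2K, and a (m) is read as a (2K + 2 - m) for m ≤ 0.
  extended : ℕ → ℚ
  extended k with k ℕ.≤? 2 ℕ.* K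
  ... | yes _ = a (1 ℕ.+ (2 ℕ.* K ℕ.+ 2 ℕ.* K ∸ k))
  ... | no  _ = a (1 ℕ.+ (k ∸ 2 ℕ.* K))

  extended-positive : ∀ k → Positive (extended k)
  extended-positive k with k ℕ.≤? 2 ℕ.* K
  ... | yes _ = a-positive (2 ℕ.* K ℕ.+ 2 ℕ.* K ∸ k)
  ... | no  _ = a-positive (k ∸ 2 ℕ.* K)

  -- Both readings are valid for 2K ≤ k ≤ 4K, because reflection about K + 1 preserves the range 1,
  -- ..., 2K + 1, where `a` is 1. So this lemma serves all k ≥ 2K and `extended-left` all k ≤ 4K,
  -- whichever branch `extended` takes.
  extended-right : ∀ k m → k ≡ 2 ℕ.* K ℕ.+ m → extended k ≡ a (1 ℕ.+ m)
  extended-right k m k≡2K+m with k ℕ.≤? 2 ℕ.* K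
  ... | no _ = cong (λ p → a (1 ℕ.+ p))
    (trans (cong (_∸ 2 ℕ.* K) k≡2K+m) (ℕ.m+n∸m≡n (2 ℕ.* K) m))
  ... | yes k≤2K = trans
    (a≡1 (2 ℕ.* K ℕ.+ 2 ℕ.* K ∸ k)
      (ℕ.m≤n+o⇒m∸n≤o _ k (ℕ.+-monoˡ-≤ (2 ℕ.* K) (ℕ.m+n≤o⇒m≤o (2 ℕ.* K) 2K+m≤k))))
    (sym (a≡1 m (ℕ.≤-trans (ℕ.m+n≤o⇒n≤o (2 ℕ.* K) 2K+m≤k) k≤2K)))
    where
    2K+m≤k : 2 ℕ.* K ℕ.+ m ≤ k
    2K+m≤k = ℕ.≤-reflexive (sym k≡2K+m)

  extended-left : ∀ k m → k ℕ.+ m ≡ 2 ℕ.* K ℕ.+ 2 ℕ.* K → extended k ≡ a (1 ℕ.+ m)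
  extended-left k m k+m≡4K with k ℕ.≤? 2 ℕ.* K
  ... | yes _ = cong (λ p → a (1 ℕ.+ p))
    (trans (cong (_∸ k) (sym k+m≡4K)) (ℕ.m+n∸m≡n k m))
  ... | no k≰2K = trans
    (a≡1 (k ∸ 2 ℕ.* K) (ℕ.m≤n+o⇒m∸n≤o k (2 ℕ.* K) (ℕ.m+n≤o⇒m≤o k k+m≤4K)))
    (sym (a≡1 m (ℕ.+-cancelˡ-≤ (2 ℕ.* K) m (2 ℕ.* K)
      (ℕ.≤-trans (ℕ.+-monoˡ-≤ m (ℕ.<⇒≤ (ℕ.≰⇒> k≰2K))) k+m≤4K))))
    where
    k+m≤4K : k ℕ.+ m ≤ 2 ℕ.* K ℕ.+ 2 ℕ.* K
    k+m≤4K = ℕ.≤-reflexive k+m≡4K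

  -- For k ≥ 2K all six indices can be read directly. For k < 2K all six are at most 4K and can be
  -- reflected; this swaps the factors in each product and the two single terms, giving the
  -- recurrence at m = 2K - 1 - k.
  extended-recurrence : ∀ k → extended (1 ℕ.+ (2 ℕ.* K ℕ.+ k)) * extended k
    ≡ extended (2 ℕ.* K ℕ.+ k) * extended (1 ℕ.+ k)
    + extended (1 ℕ.+ (K ℕ.+ k)) + extended (K ℕ.+ k)
  extended-recurrence k with ℕ.≤-<-connex (2 ℕ.* K) k
  ... | inj₁ 2K≤k with ℕ.m≤n⇒∃[o]m+o≡n 2K≤k
  ...   | m , refl = begin
    extended (1 ℕ.+ (2 ℕ.* K ℕ.+ k)) * extended k
      ≡⟨ cong₂ _*_ (extended-right _ (1 ℕ.+ (2 ℕ.* K ℕ.+ m)) (sym (ℕ.+-suc (2 ℕ.* K) (2 ℕ.* K ℕ.+ m))))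
                   (extended-right _ m refl) ⟩
    a (2 ℕ.+ (2 ℕ.* K ℕ.+ m)) * a (1 ℕ.+ m)
      ≡⟨ a-recurrence m ⟩
    a (1 ℕ.+ (2 ℕ.* K ℕ.+ m)) * a (2 ℕ.+ m) + a (2 ℕ.+ (K ℕ.+ m)) + a (1 ℕ.+ (K ℕ.+ m))
      ≡⟨ cong₂ _+_ (cong₂ _+_ (cong₂ _*_
           (extended-right _ (2 ℕ.* K ℕ.+ m) refl)
           (extended-right _ (1 ℕ.+ m) (sym (ℕ.+-suc (2 ℕ.* K) m))))
           (extended-right _ (1 ℕ.+ (K ℕ.+ m)) shift₁))
           (extended-right _ (K ℕ.+ m) shift₂) ⟨
    extended (2 ℕ.* K ℕ.+ k) * extended (1 ℕ.+ k)
      + extended (1 ℕ.+ (K ℕ.+ k)) + extended (K ℕ.+ k) ∎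
    where
    shift₁ : 1 ℕ.+ (K ℕ.+ (2 ℕ.* K ℕ.+ m)) ≡ 2 ℕ.* K ℕ.+ (1 ℕ.+ (K ℕ.+ m))
    shift₁ = solve (K ∷ m ∷ [])
    shift₂ : K ℕ.+ (2 ℕ.* K ℕ.+ m) ≡ 2 ℕ.* K ℕ.+ (K ℕ.+ m)
    shift₂ = solve (K ∷ m ∷ [])
  extended-recurrence k | inj₂ k<2K with ℕ.m≤n⇒∃[o]m+o≡n k<2K
  ...   | m , 1+k+m≡2K = begin
    extended (1 ℕ.+ (2 ℕ.* K ℕ.+ k)) * extended k
      ≡⟨ cong₂ _*_ (reflect _ m reflect₁) (reflect _ (1 ℕ.+ (2 ℕ.* K ℕ.+ m)) reflect₂) ⟩
    a (1 ℕ.+ m) * a (2 ℕ.+ (2 ℕ.* K ℕ.+ m))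
      ≡⟨ *-comm (a (1 ℕ.+ m)) _ ⟩
    a (2 ℕ.+ (2 ℕ.* K ℕ.+ m)) * a (1 ℕ.+ m)
      ≡⟨ a-recurrence m ⟩
    a (1 ℕ.+ (2 ℕ.* K ℕ.+ m)) * a (2 ℕ.+ m) + a (2 ℕ.+ (K ℕ.+ m)) + a (1 ℕ.+ (K ℕ.+ m))
      ≡⟨ solveℚ 4 (λ x y z w → x :* y :+ z :+ w := y :* x :+ w :+ z) refl
           (a (1 ℕ.+ (2 ℕ.* K ℕ.+ m))) (a (2 ℕ.+ m)) (a (2 ℕ.+ (K ℕ.+ m))) (a (1 ℕ.+ (K ℕ.+ m))) ⟩
    a (2 ℕ.+ m) * a (1 ℕ.+ (2 ℕ.* K ℕ.+ m)) + a (1 ℕ.+ (K ℕ.+ m)) + a (2 ℕ.+ (K ℕ.+ m))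
      ≡⟨ cong₂ _+_ (cong₂ _+_ (cong₂ _*_
           (reflect _ (1 ℕ.+ m) reflect₃) (reflect _ (2 ℕ.* K ℕ.+ m) reflect₄))
           (reflect _ (K ℕ.+ m) reflect₅)) (reflect _ (1 ℕ.+ (K ℕ.+ m)) reflect₆) ⟨
    extended (2 ℕ.* K ℕ.+ k) * extended (1 ℕ.+ k)
      + extended (1 ℕ.+ (K ℕ.+ k)) + extended (K ℕ.+ k) ∎
    where
    reflect : ∀ p q → p ℕ.+ q ≡ 2 ℕ.* K ℕ.+ (1 ℕ.+ (k ℕ.+ m)) → extended p ≡ a (1 ℕ.+ q)
    reflect p q p+q≡ = extended-left p q (trans p+q≡ (cong (2 ℕ.* K ℕ.+_) 1+k+m≡2K))
    reflect₁ : 1 ℕ.+ (2 ℕ.* K ℕ.+ k) ℕ.+ m ≡ 2 ℕ.* K ℕ.+ (1 ℕ.+ (k ℕ.+ m))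
    reflect₁ = solve (K ∷ k ∷ m ∷ [])
    reflect₂ : k ℕ.+ (1 ℕ.+ (2 ℕ.* K ℕ.+ m)) ≡ 2 ℕ.* K ℕ.+ (1 ℕ.+ (k ℕ.+ m))
    reflect₂ = solve (K ∷ k ∷ m ∷ [])
    reflect₃ : 2 ℕ.* K ℕ.+ k ℕ.+ (1 ℕ.+ m) ≡ 2 ℕ.* K ℕ.+ (1 ℕ.+ (k ℕ.+ m))
    reflect₃ = solve (K ∷ k ∷ m ∷ [])
    reflect₄ : 1 ℕ.+ k ℕ.+ (2 ℕ.* K ℕ.+ m) ≡ 2 ℕ.* K ℕ.+ (1 ℕ.+ (k ℕ.+ m))
    reflect₄ = solve (K ∷ k ∷ m ∷ [])
    reflect₅ : 1 ℕ.+ (K ℕ.+ k) ℕ.+ (K ℕ.+ m) ≡ 2 ℕ.* K ℕ.+ (1 ℕ.+ (k ℕ.+ m))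
    reflect₅ = solve (K ∷ k ∷ m ∷ [])
    reflect₆ : K ℕ.+ k ℕ.+ (1 ℕ.+ (K ℕ.+ m)) ≡ 2 ℕ.* K ℕ.+ (1 ℕ.+ (k ℕ.+ m))
    reflect₆ = solve (K ∷ k ∷ m ∷ [])

  -- Closed forms up to index 4K + 2.

  K+i≤2K : ∀ {i} → i ≤ K → K ℕ.+ i ≤ 2 ℕ.* K
  K+i≤2K i≤K = ℕ.+-monoʳ-≤ K (ℕ.≤-trans i≤K (ℕ.m≤m+n K 0))

  i≤2K : ∀ {i} → i ≤ K → i ≤ 2 ℕ.* K
  i≤2K i≤K = ℕ.≤-trans i≤K (ℕ.m≤m+n K _)

  -- In this range both `a (1 + n)` and `a (2 + n)` are initial values, so the recurrence becomes a
  -- summation.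
  a-recurrence-1 : ∀ n → 1 ℕ.+ n ≤ 2 ℕ.* K →
    a (2 ℕ.+ (2 ℕ.* K ℕ.+ n))
      ≡ a (1 ℕ.+ (2 ℕ.* K ℕ.+ n)) + a (2 ℕ.+ (K ℕ.+ n)) + a (1 ℕ.+ (K ℕ.+ n))
  a-recurrence-1 n n<2K = begin
    a (2 ℕ.+ (2 ℕ.* K ℕ.+ n))                  ≡⟨ *-identityʳ _ ⟨
    a (2 ℕ.+ (2 ℕ.* K ℕ.+ n)) * 1ℚ             ≡⟨ cong (a (2 ℕ.+ (2 ℕ.* K ℕ.+ n)) *_) (a≡1 n (ℕ.<⇒≤ n<2K)) ⟨
    a (2 ℕ.+ (2 ℕ.* K ℕ.+ n)) * a (1 ℕ.+ n)    ≡⟨ a-recurrence n ⟩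
    x * a (2 ℕ.+ n) + y + z                    ≡⟨ cong (λ t → x * t + y + z) (a≡1 (1 ℕ.+ n) n<2K) ⟩
    x * 1ℚ + y + z                             ≡⟨ cong (λ t → t + y + z) (*-identityʳ x) ⟩
    x + y + z                                  ∎
    where
    x = a (1 ℕ.+ (2 ℕ.* K ℕ.+ n))
    y = a (2 ℕ.+ (K ℕ.+ n))
    z = a (1 ℕ.+ (K ℕ.+ n))

  -- Each increment is the sum of two initial values, that is 2.
  a[2K+1+i] : ∀ i → i ≤ K → a (1 ℕ.+ (2 ℕ.* K ℕ.+ i)) ≡ ι (1 ℕ.+ 2 ℕ.* i)
  a[2K+1+i] zero _ = a≡1 (2 ℕ.* K ℕ.+ 0) (ℕ.≤-reflexive (ℕ.+-identityʳ (2 ℕ.* K)))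
  a[2K+1+i] (suc i) i<K = begin
    a (1 ℕ.+ (2 ℕ.* K ℕ.+ suc i))
      ≡⟨ cong (λ p → a (1 ℕ.+ p)) (ℕ.+-suc (2 ℕ.* K) i) ⟩
    a (2 ℕ.+ (2 ℕ.* K ℕ.+ i))
      ≡⟨ a-recurrence-1 i (i≤2K i<K) ⟩
    a (1 ℕ.+ (2 ℕ.* K ℕ.+ i)) + a (2 ℕ.+ (K ℕ.+ i)) + a (1 ℕ.+ (K ℕ.+ i))
      ≡⟨ cong₂ _+_ (cong₂ _+_
           (a[2K+1+i] i (ℕ.<⇒≤ i<K))
           (a≡1 (1 ℕ.+ (K ℕ.+ i)) (subst (_≤ 2 ℕ.* K) (ℕ.+-suc K i) (K+i≤2K i<K))))
           (a≡1 (K ℕ.+ i) (K+i≤2K (ℕ.<⇒≤ i<K))) ⟩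
    ι (1 ℕ.+ 2 ℕ.* i) + ι 1 + ι 1
      ≡⟨ ι-homo-+-+ (1 ℕ.+ 2 ℕ.* i) 1 1 ⟩
    ι (1 ℕ.+ 2 ℕ.* i ℕ.+ 1 ℕ.+ 1)
      ≡⟨ cong ι shift ⟩
    ι (1 ℕ.+ 2 ℕ.* suc i) ∎
    where
    shift : 1 ℕ.+ 2 ℕ.* i ℕ.+ 1 ℕ.+ 1 ≡ 1 ℕ.+ 2 ℕ.* (1 ℕ.+ i)
    shift = solve (i ∷ [])

  -- The increments are (2i + 1) + (2i + 3) = 4(i + 1) by the previous closed form, and they add up
  -- to 2i(i + 1).
  a[3K+1+i] : ∀ i → i ≤ K →
    a (1 ℕ.+ (2 ℕ.* K ℕ.+ (K ℕ.+ i))) ≡ ι (1 ℕ.+ 2 ℕ.* K ℕ.+ 2 ℕ.* i ℕ.* (1 ℕ.+ i))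
  a[3K+1+i] zero _ = begin
    a (1 ℕ.+ (2 ℕ.* K ℕ.+ (K ℕ.+ 0)))  ≡⟨ cong (λ p → a (1 ℕ.+ (2 ℕ.* K ℕ.+ p))) (ℕ.+-identityʳ K) ⟩
    a (1 ℕ.+ (2 ℕ.* K ℕ.+ K))          ≡⟨ a[2K+1+i] K ℕ.≤-refl ⟩
    ι (1 ℕ.+ 2 ℕ.* K)                  ≡⟨ cong ι (ℕ.+-identityʳ (1 ℕ.+ 2 ℕ.* K)) ⟨
    ι (1 ℕ.+ 2 ℕ.* K ℕ.+ 0)            ∎
  a[3K+1+i] (suc i) i<K = begin
    a (1 ℕ.+ (2 ℕ.* K ℕ.+ (K ℕ.+ suc i)))
      ≡⟨ cong (λ p → a (1 ℕ.+ p)) shift₁ ⟩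
    a (2 ℕ.+ (2 ℕ.* K ℕ.+ (K ℕ.+ i)))
      ≡⟨ a-recurrence-1 (K ℕ.+ i) (subst (_≤ 2 ℕ.* K) (ℕ.+-suc K i) (K+i≤2K i<K)) ⟩
    a (1 ℕ.+ (2 ℕ.* K ℕ.+ (K ℕ.+ i))) + a (2 ℕ.+ (K ℕ.+ (K ℕ.+ i))) + a (1 ℕ.+ (K ℕ.+ (K ℕ.+ i)))
      ≡⟨ cong₂ _+_ (cong₂ _+_
           (a[3K+1+i] i (ℕ.<⇒≤ i<K))
           (trans (cong (λ p → a (1 ℕ.+ p)) shift₂) (a[2K+1+i] (suc i) i<K)))
           (trans (cong (λ p → a (1 ℕ.+ p)) shift₃) (a[2K+1+i] i (ℕ.<⇒≤ i<K))) ⟩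
    ι (1 ℕ.+ 2 ℕ.* K ℕ.+ 2 ℕ.* i ℕ.* (1 ℕ.+ i)) + ι (1 ℕ.+ 2 ℕ.* suc i) + ι (1 ℕ.+ 2 ℕ.* i)
      ≡⟨ ι-homo-+-+ (1 ℕ.+ 2 ℕ.* K ℕ.+ 2 ℕ.* i ℕ.* (1 ℕ.+ i)) _ _ ⟩
    ι (1 ℕ.+ 2 ℕ.* K ℕ.+ 2 ℕ.* i ℕ.* (1 ℕ.+ i) ℕ.+ (1 ℕ.+ 2 ℕ.* suc i) ℕ.+ (1 ℕ.+ 2 ℕ.* i))
      ≡⟨ cong ι sum ⟩
    ι (1 ℕ.+ 2 ℕ.* K ℕ.+ 2 ℕ.* suc i ℕ.* (1 ℕ.+ suc i)) ∎
    where
    shift₁ : 2 ℕ.* K ℕ.+ (K ℕ.+ (1 ℕ.+ i)) ≡ 1 ℕ.+ (2 ℕ.* K ℕ.+ (K ℕ.+ i))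
    shift₁ = solve (K ∷ i ∷ [])
    shift₂ : 1 ℕ.+ (K ℕ.+ (K ℕ.+ i)) ≡ 2 ℕ.* K ℕ.+ (1 ℕ.+ i)
    shift₂ = solve (K ∷ i ∷ [])
    shift₃ : K ℕ.+ (K ℕ.+ i) ≡ 2 ℕ.* K ℕ.+ i
    shift₃ = solve (K ∷ i ∷ [])
    sum : 1 ℕ.+ 2 ℕ.* K ℕ.+ 2 ℕ.* i ℕ.* (1 ℕ.+ i) ℕ.+ (1 ℕ.+ 2 ℕ.* (1 ℕ.+ i)) ℕ.+ (1 ℕ.+ 2 ℕ.* i)
      ≡ 1 ℕ.+ 2 ℕ.* K ℕ.+ 2 ℕ.* (1 ℕ.+ i) ℕ.* (1 ℕ.+ (1 ℕ.+ i))
    sum = solve (K ∷ i ∷ [])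

  -- This is where the coefficient comes from: a (2K+2) - a 2 = 2, and a (4K+2) - a (4K) = (6K² +
  -- 16K + 9) - (2K² + 1) is twice the coefficient. The last term is a (4K), the reflection of index
  -- 2 - 2K.
  a[4K+2] : ∀ k → 1 ℕ.+ k ≡ K →
    a (2 ℕ.+ (2 ℕ.* K ℕ.+ 2 ℕ.* K))
      ≡ coefficient K * (a (2 ℕ.+ 2 ℕ.* K) - a 2) + a (1 ℕ.+ (2 ℕ.* K ℕ.+ (K ℕ.+ k)))
  a[4K+2] k 1+k≡K = begin
    x                                                     ≡⟨ *-identityʳ x ⟨
    x * 1ℚ                                                ≡⟨ cong (x *_) (a≡1 (2 ℕ.* K) ℕ.≤-refl) ⟨
    x * a (1 ℕ.+ 2 ℕ.* K)                                 ≡⟨ a-recurrence (2 ℕ.* K) ⟩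
    a (1 ℕ.+ (2 ℕ.* K ℕ.+ 2 ℕ.* K)) * a (2 ℕ.+ 2 ℕ.* K)
      + a (2 ℕ.+ (K ℕ.+ 2 ℕ.* K)) + a (1 ℕ.+ (K ℕ.+ 2 ℕ.* K))
      ≡⟨ cong₂ _+_ (cong₂ _+_ (cong₂ _*_
           (trans (cong (λ p → a (1 ℕ.+ p)) shift₁) (a[3K+1+i] K ℕ.≤-refl))
           a[2K+2])
           (trans (cong (λ p → a (1 ℕ.+ p)) shift₂) (a[3K+1+i] 1 1≤K)))
           (trans (cong (λ p → a (1 ℕ.+ p)) (ℕ.+-comm K (2 ℕ.* K))) (a[2K+1+i] K ℕ.≤-refl)) ⟩
    ι (1 ℕ.+ 2 ℕ.* K ℕ.+ 2 ℕ.* K ℕ.* (1 ℕ.+ K)) * ι 3 + ι (1 ℕ.+ 2 ℕ.* K ℕ.+ 4) + ι (1 ℕ.+ 2 ℕ.* K)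
      ≡⟨ cong (λ t → t + ι (1 ℕ.+ 2 ℕ.* K ℕ.+ 4) + ι (1 ℕ.+ 2 ℕ.* K))
           (ι-homo-* (1 ℕ.+ 2 ℕ.* K ℕ.+ 2 ℕ.* K ℕ.* (1 ℕ.+ K)) 3) ⟨
    ι ((1 ℕ.+ 2 ℕ.* K ℕ.+ 2 ℕ.* K ℕ.* (1 ℕ.+ K)) ℕ.* 3) + ι (1 ℕ.+ 2 ℕ.* K ℕ.+ 4) + ι (1 ℕ.+ 2 ℕ.* K)
      ≡⟨ ι-homo-+-+ ((1 ℕ.+ 2 ℕ.* K ℕ.+ 2 ℕ.* K ℕ.* (1 ℕ.+ K)) ℕ.* 3) _ _ ⟩
    ι ((1 ℕ.+ 2 ℕ.* K ℕ.+ 2 ℕ.* K ℕ.* (1 ℕ.+ K)) ℕ.* 3 ℕ.+ (1 ℕ.+ 2 ℕ.* K ℕ.+ 4) ℕ.+ (1 ℕ.+ 2 ℕ.* K))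
      ≡⟨ cong ι (sum K 1+k≡K) ⟩
    ι (c ℕ.* 2 ℕ.+ (1 ℕ.+ 2 ℕ.* K ℕ.+ 2 ℕ.* k ℕ.* (1 ℕ.+ k)))
      ≡⟨ ι-homo-+ (c ℕ.* 2) _ ⟩
    ι (c ℕ.* 2) + ι (1 ℕ.+ 2 ℕ.* K ℕ.+ 2 ℕ.* k ℕ.* (1 ℕ.+ k))
      -- `ι 2` and `ι 3 - ι 1` compute to the same rational.
      ≡⟨ cong₂ _+_ (ι-homo-* c 2) (sym (a[3K+1+i] k k≤K)) ⟩
    coefficient K * (ι 3 - ι 1) + a (1 ℕ.+ (2 ℕ.* K ℕ.+ (K ℕ.+ k)))
      ≡⟨ cong₂ (λ p q → coefficient K * (p - q) + a (1 ℕ.+ (2 ℕ.* K ℕ.+ (K ℕ.+ k))))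
           a[2K+2] (a≡1 1 (i≤2K 1≤K)) ⟨
    coefficient K * (a (2 ℕ.+ 2 ℕ.* K) - a 2) + a (1 ℕ.+ (2 ℕ.* K ℕ.+ (K ℕ.+ k))) ∎
    where
    x = a (2 ℕ.+ (2 ℕ.* K ℕ.+ 2 ℕ.* K))
    c = 2 ℕ.* K ℕ.^ 2 ℕ.+ 8 ℕ.* K ℕ.+ 4
    k≤K : k ≤ K
    k≤K = ℕ.m+n≤o⇒n≤o 1 (ℕ.≤-reflexive 1+k≡K)
    a[2K+2] : a (2 ℕ.+ 2 ℕ.* K) ≡ ι 3
    a[2K+2] = trans (cong (λ p → a (1 ℕ.+ p)) (ℕ.+-comm 1 (2 ℕ.* K))) (a[2K+1+i] 1 1≤K)
    shift₁ : 2 ℕ.* K ℕ.+ 2 ℕ.* K ≡ 2 ℕ.* K ℕ.+ (K ℕ.+ K)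
    shift₁ = solve (K ∷ [])
    shift₂ : 1 ℕ.+ (K ℕ.+ 2 ℕ.* K) ≡ 2 ℕ.* K ℕ.+ (K ℕ.+ 1)
    shift₂ = solve (K ∷ [])
    -- Quantifying over `K` lets `refl` replace it by 1 + k, leaving a polynomial identity in k. The
    -- factor K * (K * 1) is K ^ 2 unfolded.
    sum : ∀ K → 1 ℕ.+ k ≡ K →
      (1 ℕ.+ 2 ℕ.* K ℕ.+ 2 ℕ.* K ℕ.* (1 ℕ.+ K)) ℕ.* 3 ℕ.+ (1 ℕ.+ 2 ℕ.* K ℕ.+ 4) ℕ.+ (1 ℕ.+ 2 ℕ.* K)
        ≡ (2 ℕ.* (K ℕ.* (K ℕ.* 1)) ℕ.+ 8 ℕ.* K ℕ.+ 4) ℕ.* 2 ℕ.+ (1 ℕ.+ 2 ℕ.* K ℕ.+ 2 ℕ.* k ℕ.* (1 ℕ.+ k))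
    sum K refl = solve (k ∷ [])

  -- The array of the extended sequence and its initial columns.

  -- Entry (j, i) belongs to the index (j - 2)K + i + 1, so row 0 starts in the reflected part.
  array : ℕ → ℕ → ℚ
  array j i = extended (j ℕ.* K ℕ.+ i)

  array-recurrence : ∀ j i → array (2 ℕ.+ j) (1 ℕ.+ i) * array j i
    ≡ array (2 ℕ.+ j) i * array j (1 ℕ.+ i) + array (1 ℕ.+ j) (1 ℕ.+ i) + array (1 ℕ.+ j) i
  array-recurrence j i = begin
    array (2 ℕ.+ j) (1 ℕ.+ i) * array j i
      ≡⟨ cong (λ p → extended p * extended k) shift₁ ⟩
    extended (1 ℕ.+ (2 ℕ.* K ℕ.+ k)) * extended k
      ≡⟨ extended-recurrence k ⟩
    extended (2 ℕ.* K ℕ.+ k) * extended (1 ℕ.+ k) + extended (1 ℕ.+ (K ℕ.+ k)) + extended (K ℕ.+ k)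
      ≡⟨ cong₂ _+_ (cong₂ _+_ (cong₂ (λ p q → extended p * extended q)
           shift₂ (ℕ.+-suc (j ℕ.* K) i)) (cong extended shift₃)) (cong extended (ℕ.+-assoc K _ i)) ⟨
    array (2 ℕ.+ j) i * array j (1 ℕ.+ i) + array (1 ℕ.+ j) (1 ℕ.+ i) + array (1 ℕ.+ j) i ∎
    where
    k = j ℕ.* K ℕ.+ i
    shift₁ : (2 ℕ.+ j) ℕ.* K ℕ.+ (1 ℕ.+ i) ≡ 1 ℕ.+ (2 ℕ.* K ℕ.+ (j ℕ.* K ℕ.+ i))
    shift₁ = solve (K ∷ j ∷ i ∷ [])
    shift₂ : (2 ℕ.+ j) ℕ.* K ℕ.+ i ≡ 2 ℕ.* K ℕ.+ (j ℕ.* K ℕ.+ i)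
    shift₂ = solve (K ∷ j ∷ i ∷ [])
    shift₃ : (1 ℕ.+ j) ℕ.* K ℕ.+ (1 ℕ.+ i) ≡ 1 ℕ.+ (K ℕ.+ (j ℕ.* K ℕ.+ i))
    shift₃ = solve (K ∷ j ∷ i ∷ [])

  -- The four indices are 1 - 2K, 1, 2K + 1, 4K + 1. The middle two values are both 1 and the outer
  -- two are reflections of each other, so the relation holds for every coefficient.
  array-combination-0 : Combination (coefficient K) (array 0) (array 2) (array 4) (array 6) 0
  array-combination-0 = begin
    array 6 0                 ≡⟨ extended-right _ (2 ℕ.* K ℕ.+ 2 ℕ.* K) shift ⟩
    a[4K+1]                   ≡⟨ solveℚ 3 (λ c o x → x := c :* (o :- o) :+ x) refl (coefficient K) 1ℚ a[4K+1] ⟩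
    coefficient K * (1ℚ - 1ℚ) + a[4K+1]
      ≡⟨ cong₂ _+_ (cong₂ (λ p q → coefficient K * (p - q))
           (trans (extended-right _ (2 ℕ.* K) shift′) (a≡1 _ ℕ.≤-refl))
           (trans (extended-right _ 0 refl) (a≡1 0 z≤n)))
           (extended-left 0 _ refl) ⟨
    coefficient K * (array 4 0 - array 2 0) + array 0 0 ∎
    where
    a[4K+1] = a (1 ℕ.+ (2 ℕ.* K ℕ.+ 2 ℕ.* K))
    shift : 6 ℕ.* K ℕ.+ 0 ≡ 2 ℕ.* K ℕ.+ (2 ℕ.* K ℕ.+ 2 ℕ.* K)
    shift = solve (K ∷ [])
    shift′ : 4 ℕ.* K ℕ.+ 0 ≡ 2 ℕ.* K ℕ.+ 2 ℕ.* K
    shift′ = solve (K ∷ [])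

  array-combination-1 : Combination (coefficient K) (array 0) (array 2) (array 4) (array 6) 1
  array-combination-1 with ℕ.m≤n⇒∃[o]m+o≡n 1≤K
  ... | k , 1+k≡K = begin
    array 6 1                 ≡⟨ extended-right _ (1 ℕ.+ (2 ℕ.* K ℕ.+ 2 ℕ.* K)) shift ⟩
    a (2 ℕ.+ (2 ℕ.* K ℕ.+ 2 ℕ.* K))
      ≡⟨ a[4K+2] k 1+k≡K ⟩
    coefficient K * (a (2 ℕ.+ 2 ℕ.* K) - a 2) + a (1 ℕ.+ (2 ℕ.* K ℕ.+ (K ℕ.+ k)))
      ≡⟨ cong₂ _+_ (cong₂ (λ p q → coefficient K * (p - q))
           (extended-right _ (1 ℕ.+ 2 ℕ.* K) shift′)
           (extended-right _ 1 refl))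
           (extended-left 1 _ reflect) ⟨
    coefficient K * (array 4 1 - array 2 1) + array 0 1 ∎
    where
    shift : 6 ℕ.* K ℕ.+ 1 ≡ 2 ℕ.* K ℕ.+ (1 ℕ.+ (2 ℕ.* K ℕ.+ 2 ℕ.* K))
    shift = solve (K ∷ [])
    shift′ : 4 ℕ.* K ℕ.+ 1 ≡ 2 ℕ.* K ℕ.+ (1 ℕ.+ 2 ℕ.* K)
    shift′ = solve (K ∷ [])
    reflect : 1 ℕ.+ (2 ℕ.* K ℕ.+ (K ℕ.+ k)) ≡ 2 ℕ.* K ℕ.+ 2 ℕ.* K
    reflect = begin
      1 ℕ.+ (2 ℕ.* K ℕ.+ (K ℕ.+ k))   ≡⟨ solve (K ∷ k ∷ []) ⟩
      2 ℕ.* K ℕ.+ (K ℕ.+ (1 ℕ.+ k))   ≡⟨ cong (λ p → 2 ℕ.* K ℕ.+ (K ℕ.+ p)) 1+k≡K ⟩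
      2 ℕ.* K ℕ.+ (K ℕ.+ K)           ≡⟨ solve (K ∷ []) ⟩
      2 ℕ.* K ℕ.+ 2 ℕ.* K             ∎

-- Return from the array to the sequence.

lemma2 : ∀ (K : ℕ) → 1 ≤ K → ∀ (a : ℕ → ℚ) →
    IsQuadraticSequence K a → SatisfiesLinearRecurrence K a
lemma2 K 1≤K a a-quadratic n 6K+2≤n with ℕ.m≤n⇒∃[o]m+o≡n 6K+2≤n
... | m , refl = begin
  a N ≡⟨ array≡a 6 0 refl ⟨
  array 6 i ≡⟨ f-combination (coefficient K) array-combination-0 array-combination-1 i ⟩
  coefficient K * (array 4 i - array 2 i) + array 0 i
    ≡⟨ cong₂ _+_ (cong₂ (λ p q → coefficient K * (p - q)) (array≡a 4 2 refl) (array≡a 2 4 refl))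
                 (array≡a 0 6 refl) ⟩
  coefficient K * (a (N ∸ 2 ℕ.* K) - a (N ∸ 4 ℕ.* K)) + a (N ∸ 6 ℕ.* K) ∎
  where
  open ≡-Reasoning
  open QuadraticSequence K 1≤K a a-quadratic
  open QuadraticArray array (λ j i → extended-positive (j ℕ.* K ℕ.+ i)) array-recurrence
  -- The column in which row 6 has index 4K + i + 1 = N. Row 0 then has index m + 2, so all four
  -- entries lie in the original sequence.
  i = 2 ℕ.* K ℕ.+ (1 ℕ.+ m)
  N = 6 ℕ.* K ℕ.+ 2 ℕ.+ m
  array≡a : ∀ j l → j ℕ.+ l ≡ 6 → array j i ≡ a (N ∸ l ℕ.* K)
  array≡a j l j+l≡6 = trans
    (extended-right _ (j ℕ.* K ℕ.+ (1 ℕ.+ m)) shift)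
    (cong a (sym (trans (cong (_∸ l ℕ.* K) N≡) (ℕ.m+n∸m≡n (l ℕ.* K) _))))
    where
    shift : j ℕ.* K ℕ.+ (2 ℕ.* K ℕ.+ (1 ℕ.+ m)) ≡ 2 ℕ.* K ℕ.+ (j ℕ.* K ℕ.+ (1 ℕ.+ m))
    shift = solve (K ∷ j ∷ m ∷ [])
    N≡ : N ≡ l ℕ.* K ℕ.+ (1 ℕ.+ (j ℕ.* K ℕ.+ (1 ℕ.+ m)))
    N≡ = begin
      6 ℕ.* K ℕ.+ 2 ℕ.+ m                             ≡⟨ cong (λ p → p ℕ.* K ℕ.+ 2 ℕ.+ m) j+l≡6 ⟨
      (j ℕ.+ l) ℕ.* K ℕ.+ 2 ℕ.+ m                     ≡⟨ solve (K ∷ j ∷ l ∷ m ∷ []) ⟩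
      l ℕ.* K ℕ.+ (1 ℕ.+ (j ℕ.* K ℕ.+ (1 ℕ.+ m)))    ∎
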